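{- For every pair of positive integers $(\ell,k)$ with $\ell\le k$, \[a_{k, \ell}\ge \frac{2}{\ell\left(1+\sqrt{1-\frac{4(\ell-1)}{\ell^2\binom{k}{\ell}}}\right)}.\]
   Context: Let $H_{n,k}=\{0,1,\dots,n-1\}^k$. For $\ell\le k$, an $\ell$-rook is a point $P\in H_{n,k}$ together with a set $D$ of $\ell$ of the $k$ coordinate indices; it covers $P$ itself and every point of $H_{n,k}$ which differs from $P$ in exactly one coordinate, that coordinate belonging to $D$. Distinct rooks must occupy distinct points. $a_{n,k,\ell}$ is the minimum number of $\ell$-rooks whose covered sets together cover $H_{n,k}$, and $a_{k,\ell}=\lim_{n\to\infty} a_{n,k,\ell}/n^{k-1}$ (this limit exists). -}

module Defs where

open import Data.Nat using (ℕ; _+_; _*_; _∸_; _^_; _≤_; _<_)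
open import Data.Nat.Combinatorics using (_C_)
open import Data.Fin using (Fin)
open import Data.Fin.Subset using (Subset; _∈_; ∣_∣)
open import Data.Vec using (Vec; lookup)
open import Data.List using (List; map; length)
open import Data.List.Membership.Propositional using () renaming (_∈_ to _∈ₗ_)
open import Data.List.Relation.Unary.Unique.Propositional using (Unique)
open import Data.Product using (Σ; _×_; ∃; ∃-syntax; proj₁)
open import Data.Sum using (_⊎_)
open import Relation.Binary.PropositionalEquality using (_≡_; _≢_)

Point : ℕ → ℕ → Set
Point n k = Vec (Fin n) k

record Rook (n k ℓ : ℕ) : Set where
  constructor rook
  field
    pos  : Point n k
    dirs : Subset k
    size : ∣ dirs ∣ ≡ ℓ
open Rook public

DiffersExactlyOnceIn : ∀ {n k} → Subset k → Point n k → Point n k → Set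
DiffersExactlyOnceIn {n} {k} D P Q =
  ∃[ i ] (i ∈ D × lookup Q i ≢ lookup P i × (∀ j → j ≢ i → lookup Q j ≡ lookup P j))

Covers : ∀ {n k ℓ} → Rook n k ℓ → Point n k → Set
Covers R Q = Q ≡ pos R ⊎ DiffersExactlyOnceIn (dirs R) (pos R) Q

IsRookCover : ∀ {n k ℓ} → List (Rook n k ℓ) → Set
IsRookCover {n} {k} Rs =
  Unique (map pos Rs) × (∀ (Q : Point n k) → ∃[ R ] (R ∈ₗ Rs × Covers R Q))

-- BelowBound k ℓ p q  ⇔  p/q < 2 / (ℓ (1 + √(1 - 4(ℓ-1)/(ℓ² C(k,ℓ))))),
-- for p ≥ 0, q > 0, ℓ ≥ 1 (denominators cleared; the radicand is ≥ 0 since ℓ² ≥ 4(ℓ-1)).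
-- With u = ℓp/q, s = √(1-x):  u(1+s) < 2  ⇔  u < 2  ∧  u²(1-x) < (2-u)².
BelowBound : ℕ → ℕ → ℕ → ℕ → Set
BelowBound k ℓ p q =
  ℓ * p < 2 * q ×
  (ℓ * p) ^ 2 * (ℓ ^ 2 * (k C ℓ) ∸ 4 * (ℓ ∸ 1)) < (2 * q ∸ ℓ * p) ^ 2 * (ℓ ^ 2 * (k C ℓ))

{-# OPTIONS --safe #-}
module Submission where

-- Write t = ℓ − 1, c = k C ℓ and, for a point Q and a direction set D, let S_D(Q) be the number of
-- directions i ∈ D whose line through Q contains a rook with direction set D.  Since S_D ≤ ℓ and every Q has
-- some S_D(Q) ≥ 1, summing over D gives Σ S_D (S_D − 1) ≤ ℓ (Σ S_D − 1).  Now S_D (S_D − 1) counts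
-- ordered pairs i ≠ j of occupied directions, and an (i, j)-plane containing M rooks of type D has
-- A B points occupied in both, where A, B ≤ min(M, n) count its occupied lines in direction i and j.
-- For A = B = M the quantity A B − ℓ n (A + B) / 2t is a convex quadratic in M, and its tangent line
-- at M = n p / (q c) bounds it from below for all admissible A, B, M as long as t p ≤ q c.  Summing
-- the tangent bound over all planes and types gives q² c N ≤ q w |R| + p² t N with N = n^(k−1) and
-- w = ℓ q c − 2 t p.  The hypothesis on p / q says exactly ℓ q c p < q² c + t p², which forces
-- p N ≤ q |R|.

open import Defs
open import Algebra.Properties.CommutativeSemigroup using (x∙yz≈y∙xz)
import Data.Bool.Properties as Bool
open import Data.Empty using (⊥; ⊥-elim)
open import Data.Fin using (Fin; zero; suc)
import Data.Fin.Properties as Fin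
open import Data.Fin.Subset using (Subset; ∣_∣; inside; outside) renaming (_∈_ to _∈ₛ_)
open import Data.List using (List; []; _∷_; map; _++_; length; allFin; cartesianProductWith)
open import Data.List.Properties using (map-++; map-∘; length-tabulate; length-++; length-map)
open import Data.List.Membership.Propositional using (_∈_)
open import Data.List.Membership.Propositional.Properties
  using (∈-allFin; ∈-map⁺; ∈-map⁻; ∈-++⁺ˡ; ∈-++⁺ʳ)
open import Data.List.Relation.Unary.All as All using (All; []; _∷_)
import Data.List.Relation.Unary.All.Properties as All
open import Data.List.Relation.Unary.AllPairs using ([]; _∷_)
open import Data.List.Relation.Unary.Any using (here; there)
open import Data.List.Relation.Unary.Unique.Propositional using (Unique)
import Data.List.Relation.Unary.Unique.Propositional.Properties as Unique
open import Data.Nat using (ℕ; zero; suc; _+_; _*_; _∸_; _^_; _⊓_; _≤_; _<_; z≤n; s≤s; NonZero; >-nonZero)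
open import Data.Nat.Combinatorics using (_C_; nCk+nC[k+1]≡[n+1]C[k+1]; nCn≡1; nCk≡nC[n∸k])
open import Data.Nat.ListAction using (sum)
open import Data.Nat.ListAction.Properties using (sum-++)
open import Data.Nat.Properties hiding (_≟_)
open import Data.Nat.Tactic.RingSolver using (solve-∀)
open import Data.Product using (_×_; _,_; proj₁; proj₂; uncurry; ∃-syntax)
open import Data.Sum using (inj₁; inj₂; [_,_]′)
open import Data.Vec using (Vec; []; _∷_; _[_]≔_; here; there; lookup)
open import Data.Vec.Properties
  using (≡-dec; ∷-injective; []≔-lookup; []≔-commutes; []≔-idempotent; lookup∘update; lookup∘update′)
open import Data.Vec.Relation.Binary.Pointwise.Extensional using (ext; Pointwise-≡⇒≡)
open import Function using (id; _∘_)
open import Relation.Binary using (DecidableEquality)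
open import Relation.Binary.PropositionalEquality
open import Relation.Nullary using (yes; no)

-- Numerical inequalities

2xy≤x²+y² : ∀ x y → 2 * (x * y) ≤ x * x + y * y
2xy≤x²+y² x y = [ ordered x y , swapped ]′ (≤-total x y)
  where
  open ≤-Reasoning
  expand : ∀ x d → x * x + (x + d) * (x + d) ≡ 2 * (x * (x + d)) + d * d
  expand = solve-∀
  ordered : ∀ x y → x ≤ y → 2 * (x * y) ≤ x * x + y * y
  ordered x y x≤y with d , refl ← m≤n⇒∃[o]m+o≡n x≤y =
    subst (2 * (x * (x + d)) ≤_) (sym (expand x d)) (m≤m+n _ (d * d))
  swapped : y ≤ x → 2 * (x * y) ≤ x * x + y * y
  swapped y≤x = begin
    2 * (x * y)   ≡⟨ cong (2 *_) (*-comm x y) ⟩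
    2 * (y * x)   ≤⟨ ordered y x y≤x ⟩
    y * y + x * x ≡⟨ +-comm (y * y) (x * x) ⟩
    x * x + y * y ∎

-- With s = t p + d the difference of the two sides is t (t - 1) (t - 2) p² + 2 t (t - 1) p d + (t +
-- 1) d², and every coefficient is nonnegative for t ≥ 1. The cases t = 1 and t = r + 2 express
-- these coefficients without subtraction.
4tps≤ : ∀ t p s → 1 ≤ t → t * p ≤ s →
  4 * (t * p * s) ≤ suc t * (s * s) + 2 * (t * (p * p))
4tps≤ t p s 1≤t tp≤s with d , refl ← m≤n⇒∃[o]m+o≡n tp≤s = go t 1≤t
  where
  base : ∀ p d →
    2 * ((1 * p + d) * (1 * p + d)) + 2 * (1 * (p * p))
    ≡ 4 * (1 * p * (1 * p + d)) + 2 * (d * d)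
  base = solve-∀
  step : ∀ r p d → let t = suc (suc r) in
    suc t * ((t * p + d) * (t * p + d)) + 2 * (t * (p * p))
    ≡ 4 * (t * p * (t * p + d)) + (p * p * (t * suc r * r) + 2 * t * suc r * (p * d) + suc t * (d * d))
  step = solve-∀
  go : ∀ t → 1 ≤ t →
    4 * (t * p * (t * p + d)) ≤ suc t * ((t * p + d) * (t * p + d)) + 2 * (t * (p * p))
  go (suc zero) _ = subst (4 * (1 * p * (1 * p + d)) ≤_) (sym (base p d)) (m≤m+n _ _)
  go (suc (suc r)) _ =
    subst (4 * (suc (suc r) * p * (suc (suc r) * p + d)) ≤_) (sym (step r p d)) (m≤m+n _ _)

module _ (t p s w n : ℕ) (1≤t : 1 ≤ t) (tp≤s : t * p ≤ s) (w-eq : w + 2 * (t * p) ≡ suc t * s) where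

  open ≤-Reasoning

  private
    -- The tangent bound with denominators cleared. Divided by 2 t s², the inequality `suc t * (s *
    -- s) * (n * (A + B)) ≤ upper A B M` says that A B - ℓ n (A + B) / 2t is at least -w n M / (t s)
    -- - p² n² / s², which is the tangent at M = n p / s of M² - ℓ n M / t.
    upper : ℕ → ℕ → ℕ → ℕ
    upper A B M = 2 * (t * (s * s)) * (A * B) + 2 * (s * w) * (n * M) + 2 * (t * (p * p)) * (n * n)

  -- As w = ℓ s - 2 t p, the claim amounts to 4 t p s n A ≤ ℓ s² n A + 2 t p² n². This is `4tps≤`
  -- multiplied by n A and weakened by A ≤ n.
  tangent-B≡0 : ∀ A → A ≤ n →
    suc t * (s * s) * (n * A) ≤ 2 * (s * w) * (n * A) + 2 * (t * (p * p)) * (n * n)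
  tangent-B≡0 A A≤n = +-cancelʳ-≤ (4 * (t * p * s) * (n * A)) _ _ (begin
    suc t * (s * s) * (n * A) + 4 * (t * p * s) * (n * A)
      ≤⟨ +-monoʳ-≤ (suc t * (s * s) * (n * A)) (*-monoˡ-≤ (n * A) (4tps≤ t p s 1≤t tp≤s)) ⟩
    suc t * (s * s) * (n * A) + (suc t * (s * s) + 2 * (t * (p * p))) * (n * A)
      ≡⟨ e₁ t p s n A ⟩
    2 * (suc t * s) * s * (n * A) + 2 * (t * (p * p)) * (n * A)
      ≤⟨ +-monoʳ-≤ _ (*-monoʳ-≤ (2 * (t * (p * p))) (*-monoʳ-≤ n A≤n)) ⟩
    2 * (suc t * s) * s * (n * A) + 2 * (t * (p * p)) * (n * n)
      ≡⟨ cong (λ z → 2 * z * s * (n * A) + 2 * (t * (p * p)) * (n * n)) w-eq ⟨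
    2 * (w + 2 * (t * p)) * s * (n * A) + 2 * (t * (p * p)) * (n * n)
      ≡⟨ e₂ t p s w n A ⟩
    2 * (s * w) * (n * A) + 2 * (t * (p * p)) * (n * n) + 4 * (t * p * s) * (n * A) ∎)
    where
    e₁ : ∀ t p s n A →
      suc t * (s * s) * (n * A) + (suc t * (s * s) + 2 * (t * (p * p))) * (n * A)
      ≡ 2 * (suc t * s) * s * (n * A) + 2 * (t * (p * p)) * (n * A)
    e₁ = solve-∀
    e₂ : ∀ t p s w n A →
      2 * (w + 2 * (t * p)) * s * (n * A) + 2 * (t * (p * p)) * (n * n)
      ≡ 2 * (s * w) * (n * A) + 2 * (t * (p * p)) * (n * n) + 4 * (t * p * s) * (n * A)
    e₂ = solve-∀

  -- After substituting w = ℓ s - 2 t p, the difference of the two sides is 2 t (s A - p n)², with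
  -- equality at the point of tangency.
  tangent-B≡A : ∀ A → suc t * (s * s) * (n * (A + A)) ≤ upper A A A
  tangent-B≡A A = +-cancelʳ-≤ (4 * (t * p * s) * (n * A)) _ _ (begin
    suc t * (s * s) * (n * (A + A)) + 4 * (t * p * s) * (n * A)
      ≡⟨ e₁ t p s n A ⟩
    2 * (suc t * s) * s * (n * A) + 2 * t * (2 * (s * A * (p * n)))
      ≤⟨ +-monoʳ-≤ _ (*-monoʳ-≤ (2 * t) (2xy≤x²+y² (s * A) (p * n))) ⟩
    2 * (suc t * s) * s * (n * A) + 2 * t * (s * A * (s * A) + p * n * (p * n))
      ≡⟨ cong (λ z → 2 * z * s * (n * A) + 2 * t * (s * A * (s * A) + p * n * (p * n))) w-eq ⟨
    2 * (w + 2 * (t * p)) * s * (n * A) + 2 * t * (s * A * (s * A) + p * n * (p * n))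
      ≡⟨ e₂ t p s w n A ⟩
    upper A A A + 4 * (t * p * s) * (n * A) ∎)
    where
    e₁ : ∀ t p s n A →
      suc t * (s * s) * (n * (A + A)) + 4 * (t * p * s) * (n * A)
      ≡ 2 * (suc t * s) * s * (n * A) + 2 * t * (2 * (s * A * (p * n)))
    e₁ = solve-∀
    e₂ : ∀ t p s w n A →
      2 * (w + 2 * (t * p)) * s * (n * A) + 2 * t * (s * A * (s * A) + p * n * (p * n))
      ≡ 2 * (t * (s * s)) * (A * A) + 2 * (s * w) * (n * A) + 2 * (t * (p * p)) * (n * n)
        + 4 * (t * p * s) * (n * A)
    e₂ = solve-∀

  -- The difference of the two sides is affine in B, so it suffices to treat B = 0 and B = A.
  tangent-M≡A : ∀ A B → A ≤ n → B ≤ A → suc t * (s * s) * (n * (A + B)) ≤ upper A B A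
  -- The slope in B is s² (2 t A - ℓ n): if it is nonnegative the difference is smallest at B = 0,
  -- otherwise at B = A.
  tangent-M≡A A B A≤n B≤A = [ rising , falling ]′ (≤-total (suc t * n) (2 * t * A))
    where
    rising : suc t * n ≤ 2 * t * A → suc t * (s * s) * (n * (A + B)) ≤ upper A B A
    rising slope = begin
      suc t * (s * s) * (n * (A + B))
        ≡⟨ e₁ t s n A B ⟩
      s * s * B * (suc t * n) + suc t * (s * s) * (n * A)
        ≤⟨ +-mono-≤ (*-monoʳ-≤ (s * s * B) slope) (tangent-B≡0 A A≤n) ⟩
      s * s * B * (2 * t * A) + (2 * (s * w) * (n * A) + 2 * (t * (p * p)) * (n * n))
        ≡⟨ e₂ t p s w n A B ⟩
      upper A B A ∎
      where
      e₁ : ∀ t s n A B → suc t * (s * s) * (n * (A + B))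
        ≡ s * s * B * (suc t * n) + suc t * (s * s) * (n * A)
      e₁ = solve-∀
      e₂ : ∀ t p s w n A B →
        s * s * B * (2 * t * A) + (2 * (s * w) * (n * A) + 2 * (t * (p * p)) * (n * n))
        ≡ 2 * (t * (s * s)) * (A * B) + 2 * (s * w) * (n * A) + 2 * (t * (p * p)) * (n * n)
      e₂ = solve-∀
    falling : 2 * t * A ≤ suc t * n → suc t * (s * s) * (n * (A + B)) ≤ upper A B A
    falling slope with e , B+e≡A ← m≤n⇒∃[o]m+o≡n B≤A =
      +-cancelʳ-≤ (s * s * e * (suc t * n)) _ _ (begin
        suc t * (s * s) * (n * (A + B)) + s * s * e * (suc t * n)
          ≡⟨ e₁ t s n A B e ⟩
        suc t * (s * s) * (n * (A + (B + e)))
          ≡⟨ cong (λ z → suc t * (s * s) * (n * (A + z))) B+e≡A ⟩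
        suc t * (s * s) * (n * (A + A))
          ≤⟨ tangent-B≡A A ⟩
        upper A A A
          ≡⟨ cong (λ z → upper A z A) B+e≡A ⟨
        upper A (B + e) A
          ≡⟨ e₂ t p s w n A B e ⟩
        upper A B A + s * s * e * (2 * t * A)
          ≤⟨ +-monoʳ-≤ (upper A B A) (*-monoʳ-≤ (s * s * e) slope) ⟩
        upper A B A + s * s * e * (suc t * n) ∎)
      where
      e₁ : ∀ t s n A B e → suc t * (s * s) * (n * (A + B)) + s * s * e * (suc t * n)
        ≡ suc t * (s * s) * (n * (A + (B + e)))
      e₁ = solve-∀
      e₂ : ∀ t p s w n A B e →
        2 * (t * (s * s)) * (A * (B + e)) + 2 * (s * w) * (n * A) + 2 * (t * (p * p)) * (n * n)
        ≡ 2 * (t * (s * s)) * (A * B) + 2 * (s * w) * (n * A) + 2 * (t * (p * p)) * (n * n)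
          + s * s * e * (2 * t * A)
      e₂ = solve-∀

  -- The right-hand side increases with M, so M may be lowered to the larger of A and B; the
  -- symmetry in A and B leaves the case M = A.
  tangent : ∀ A B M → A ≤ M → B ≤ M → A ≤ n → B ≤ n →
    suc t * (s * s) * (n * (A + B)) ≤ upper A B M
  tangent A B M A≤M B≤M A≤n B≤n = [ (λ A≤B → begin
      suc t * (s * s) * (n * (A + B)) ≡⟨ cong (λ z → suc t * (s * s) * (n * z)) (+-comm A B) ⟩
      suc t * (s * s) * (n * (B + A)) ≤⟨ tangent-M≡A B A B≤n A≤B ⟩
      upper B A B                     ≤⟨ upper-mono B A B≤M ⟩
      upper B A M                     ≡⟨ cong (λ z → 2 * (t * (s * s)) * z + 2 * (s * w) * (n * M)
                                           + 2 * (t * (p * p)) * (n * n)) (*-comm B A) ⟩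
      upper A B M                     ∎)
    , (λ B≤A → ≤-trans (tangent-M≡A A B A≤n B≤A) (upper-mono A B A≤M)) ]′ (≤-total A B)
    where
    upper-mono : ∀ A B {M M′} → M ≤ M′ → upper A B M ≤ upper A B M′
    upper-mono A B M≤M′ =
      +-monoˡ-≤ (2 * (t * (p * p)) * (n * n)) (+-monoʳ-≤ (2 * (t * (s * s)) * (A * B)) (*-monoʳ-≤ (2 * (s * w)) (*-monoʳ-≤ n M≤M′)))

-- Polynomial consequences of the hypothesis on p / q

private
  belowBound-ring₁ : ∀ c e t p x → c * (e * e) + 4 * (t * (p * p)) + (c * (x * x) + 2 * (c * (x * e)))
    ≡ c * ((x + e) * (x + e)) + 4 * (t * (p * p))
  belowBound-ring₁ = solve-∀
  belowBound-ring₂ : ∀ c q t p → c * (2 * q * (2 * q)) + 4 * (t * (p * p)) ≡ 4 * (q * q * c + t * (p * p))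
  belowBound-ring₂ = solve-∀
  belowBound-ring₃ : ∀ ℓ q c p → 4 * (ℓ * (q * c) * p) ≡ 2 * (c * (ℓ * p * (2 * q)))
  belowBound-ring₃ = solve-∀
  belowBound-ring₄ : ∀ c x e → 2 * (c * (x * (x + e))) ≡ c * (x * x) + (c * (x * x) + 2 * (c * (x * e)))
  belowBound-ring₄ = solve-∀
  belowBound-ring₅ : ∀ ℓ c p → ℓ * ℓ * (c * (ℓ * p * (ℓ * p))) ≡ (ℓ * p * (ℓ * p * 1)) * (ℓ * (ℓ * 1) * c)
  belowBound-ring₅ = solve-∀
  belowBound-ring₆ : ∀ ℓ p t e c → (ℓ * p * (ℓ * p * 1)) * (4 * t) + e * (e * 1) * (ℓ * (ℓ * 1) * c)
    ≡ ℓ * ℓ * (c * (e * e) + 4 * (t * (p * p)))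
  belowBound-ring₆ = solve-∀

-- With c = `k C ℓ` and e = 2 q - ℓ p, moving the term with 4 t to the other side of `BelowBound`
-- and dividing by ℓ² gives c (ℓ p)² < c e² + 4 t p². Since e² - (ℓ p)² = 4 q (q - ℓ p), division by
-- 4 yields the claim. For t ≥ 1 the bound of the theorem is the smaller root of t x² - ℓ c x + c,
-- whose positivity at x = p / q is asserted here.
belowBound⇒ : ∀ k t p q → BelowBound k (suc t) p q →
  suc t * (q * (k C suc t)) * p < q * q * (k C suc t) + t * (p * p)
belowBound⇒ k t p q (ℓp<2q , below) = ≰⇒> (λ le → <⇒≱ below′ (begin
    ℓ * ℓ * (c * (e * e) + 4 * (t * (p * p)))
      ≤⟨ *-monoʳ-≤ (ℓ * ℓ) (+-cancelʳ-≤ (c * (ℓ * p * (ℓ * p)) + 2 * (c * (ℓ * p * e))) _ _ (begin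
        c * (e * e) + 4 * (t * (p * p)) + (c * (ℓ * p * (ℓ * p)) + 2 * (c * (ℓ * p * e)))
          ≡⟨ belowBound-ring₁ c e t p (ℓ * p) ⟩
        c * ((ℓ * p + e) * (ℓ * p + e)) + 4 * (t * (p * p))
          ≡⟨ cong (λ z → c * (z * z) + 4 * (t * (p * p))) 2q≡ ⟩
        c * (2 * q * (2 * q)) + 4 * (t * (p * p))
          ≡⟨ belowBound-ring₂ c q t p ⟩
        4 * (q * q * c + t * (p * p))
          ≤⟨ *-monoʳ-≤ 4 le ⟩
        4 * (ℓ * (q * c) * p)
          ≡⟨ belowBound-ring₃ ℓ q c p ⟩
        2 * (c * (ℓ * p * (2 * q)))
          ≡⟨ cong (λ z → 2 * (c * (ℓ * p * z))) 2q≡ ⟨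
        2 * (c * (ℓ * p * (ℓ * p + e)))
          ≡⟨ belowBound-ring₄ c (ℓ * p) e ⟩
        c * (ℓ * p * (ℓ * p)) + (c * (ℓ * p * (ℓ * p)) + 2 * (c * (ℓ * p * e))) ∎)) ⟩
    ℓ * ℓ * (c * (ℓ * p * (ℓ * p)))
      ≡⟨ belowBound-ring₅ ℓ c p ⟩
    (ℓ * p) ^ 2 * (ℓ ^ 2 * c) ∎))
  where
  open ≤-Reasoning
  ℓ c e : ℕ
  ℓ = suc t
  c = k C ℓ
  e = 2 * q ∸ ℓ * p
  2q≡ : ℓ * p + e ≡ 2 * q
  2q≡ = m+[n∸m]≡n (<⇒≤ ℓp<2q)
  below′ : (ℓ * p) ^ 2 * (ℓ ^ 2 * c) < ℓ * ℓ * (c * (e * e) + 4 * (t * (p * p)))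
  below′ = begin-strict
    (ℓ * p) ^ 2 * (ℓ ^ 2 * c)
      -- The inequality x ≤ y + (x ∸ y) is true for truncated subtraction, so the sign of ℓ² c - 4 t
      -- requires no case distinction.
      ≤⟨ *-monoʳ-≤ ((ℓ * p) ^ 2) (m≤n+m∸n (ℓ ^ 2 * c) (4 * t)) ⟩
    (ℓ * p) ^ 2 * (4 * t + (ℓ ^ 2 * c ∸ 4 * t))
      ≡⟨ *-distribˡ-+ ((ℓ * p) ^ 2) (4 * t) _ ⟩
    (ℓ * p) ^ 2 * (4 * t) + (ℓ * p) ^ 2 * (ℓ ^ 2 * c ∸ 4 * t)
      <⟨ +-monoʳ-< ((ℓ * p) ^ 2 * (4 * t)) below ⟩
    (ℓ * p) ^ 2 * (4 * t) + e ^ 2 * (ℓ ^ 2 * c)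
      ≡⟨ belowBound-ring₆ ℓ p t e c ⟩
    ℓ * ℓ * (c * (e * e) + 4 * (t * (p * p))) ∎

-- If `k C ℓ` were 0, the right-hand side of the strict inequality in `BelowBound` would vanish.
1≤kCℓ : ∀ k ℓ p q → BelowBound k ℓ p q → 1 ≤ k C ℓ
1≤kCℓ k ℓ p q (_ , below) = n≢0⇒n>0 λ C≡0 → n≮0 (subst ((ℓ * p) ^ 2 * (ℓ ^ 2 * (k C ℓ) ∸ 4 * (ℓ ∸ 1)) <_) (begin
    (2 * q ∸ ℓ * p) ^ 2 * (ℓ ^ 2 * (k C ℓ)) ≡⟨ cong (λ z → (2 * q ∸ ℓ * p) ^ 2 * (ℓ ^ 2 * z)) C≡0 ⟩
    (2 * q ∸ ℓ * p) ^ 2 * (ℓ ^ 2 * 0)       ≡⟨ cong ((2 * q ∸ ℓ * p) ^ 2 *_) (*-zeroʳ (ℓ ^ 2)) ⟩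
    (2 * q ∸ ℓ * p) ^ 2 * 0                 ≡⟨ *-zeroʳ ((2 * q ∸ ℓ * p) ^ 2) ⟩
    0                                       ∎) below)
  where open ≡-Reasoning

private
  tp≤q-ring₁ : ∀ q a p → q * q + (q + a) * p ≡ q * (q + p) + a * p
  tp≤q-ring₁ = solve-∀
  tp≤q-ring₂ : ∀ q a p → q * (q + p) + a * q ≡ q * (q + a) + q * p
  tp≤q-ring₂ = solve-∀
  tp≤q-ring₃ : ∀ q t p → q * (t * p) + q * p ≡ suc t * q * p
  tp≤q-ring₃ = solve-∀

-- If q ≤ t p then (t p − q) (q − p) ≥ 0, which contradicts belowBound⇒.
tp≤q : ∀ k t p q → BelowBound k (suc t) p q → t * p ≤ q
tp≤q k zero p q _ = z≤n
tp≤q k t@(suc r) p q bb =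
  [ id , (λ q≤tp → ⊥-elim (<⇒≱ (belowBound⇒ k t p q bb) (large q≤tp))) ]′ (≤-total (t * p) q)
  where
  open ≤-Reasoning
  c : ℕ
  c = k C suc t
  p≤q : p ≤ q
  -- Here ℓ ≥ 2, so 2 p ≤ ℓ p < 2 q.
  p≤q = *-cancelˡ-≤ 2 (≤-trans (*-monoˡ-≤ p {2} {suc t} (s≤s (s≤s z≤n))) (<⇒≤ (proj₁ bb)))
  product-nonneg : q ≤ t * p → q * q + t * (p * p) ≤ suc t * q * p
  product-nonneg q≤tp with a , q+a≡tp ← m≤n⇒∃[o]m+o≡n q≤tp | b , p+b≡q ← m≤n⇒∃[o]m+o≡n p≤q = begin
    q * q + t * (p * p)             ≡⟨ cong (q * q +_) (*-assoc t p p) ⟨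
    q * q + t * p * p               ≡⟨ cong (λ z → q * q + z * p) q+a≡tp ⟨
    q * q + (q + a) * p             ≡⟨ tp≤q-ring₁ q a p ⟩
    q * (q + p) + a * p             ≤⟨ +-monoʳ-≤ (q * (q + p)) (*-monoʳ-≤ a p≤q) ⟩
    q * (q + p) + a * q             ≡⟨ tp≤q-ring₂ q a p ⟩
    q * (q + a) + q * p             ≡⟨ cong (λ z → q * z + q * p) q+a≡tp ⟩
    q * (t * p) + q * p             ≡⟨ tp≤q-ring₃ q t p ⟩
    suc t * q * p                   ∎
  large : q ≤ t * p → q * q * c + t * (p * p) ≤ suc t * (q * c) * p
  large q≤tp = begin
    q * q * c + t * (p * p)     ≡⟨ cong (q * q * c +_) (*-identityʳ (t * (p * p))) ⟨
    -- Enlarging t p² to t p² c, possible because c ≥ 1, turns the claim into c times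
    -- `product-nonneg`.
    q * q * c + t * (p * p) * 1 ≤⟨ +-monoʳ-≤ (q * q * c) (*-monoʳ-≤ (t * (p * p)) (1≤kCℓ k (suc t) p q bb)) ⟩
    q * q * c + t * (p * p) * c ≡⟨ *-distribʳ-+ c (q * q) (t * (p * p)) ⟨
    (q * q + t * (p * p)) * c   ≤⟨ *-monoˡ-≤ c (product-nonneg q≤tp) ⟩
    suc t * q * p * c           ≡⟨ e t q p c ⟩
    suc t * (q * c) * p         ∎
    where
    e : ∀ t q p c → suc t * q * p * c ≡ suc t * (q * c) * p
    e = solve-∀

private
  tangent-sum-ring₁ : ∀ q c t p N → (q * q * c + t * (p * p)) * (c * N) + t * (p * p) * c * N
    ≡ q * c * (q * c) * N + 2 * (t * p) * p * c * N
  tangent-sum-ring₁ = solve-∀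
  tangent-sum-ring₂ : ∀ q c w m t p N → q * c * w * m + t * (p * p) * c * N + 2 * (t * p) * p * c * N
    ≡ c * w * (q * m) + (t * (p * p) * c * N + 2 * (t * p) * p * c * N)
  tangent-sum-ring₂ = solve-∀
  tangent-sum-ring₃ : ∀ c w p N t → c * w * (p * N) + (t * (p * p) * c * N + 2 * (t * p) * p * c * N)
    ≡ (w + 2 * (t * p)) * p * (c * N) + t * (p * p) * c * N
  tangent-sum-ring₃ = solve-∀

-- The right-hand side of the hypothesis increases with m, so m may be replaced by p N / q.
tangent-sum⇒ : ∀ k t p q w N m → BelowBound k (suc t) p q →
  w + 2 * (t * p) ≡ suc t * (q * (k C suc t)) →
  q * (k C suc t) * (q * (k C suc t)) * N ≤ q * (k C suc t) * w * m + t * (p * p) * (k C suc t) * N →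
  p * N ≤ q * m
tangent-sum⇒ k t p q w zero m bb w-eq le = subst (_≤ q * m) (sym (*-zeroʳ p)) z≤n
tangent-sum⇒ k t p q w N@(suc _) m bb w-eq le =
  ≮⇒≥ λ qm<pN → <⇒≱ (belowBound⇒ k t p q bb)
    (*-cancelʳ-≤ _ _ (c * N) (+-cancelʳ-≤ (t * (p * p) * c * N) _ _ (begin
      (q * q * c + t * (p * p)) * (c * N) + t * (p * p) * c * N
        ≡⟨ tangent-sum-ring₁ q c t p N ⟩
      q * c * (q * c) * N + 2 * (t * p) * p * c * N
        ≤⟨ +-monoˡ-≤ _ le ⟩
      q * c * w * m + t * (p * p) * c * N + 2 * (t * p) * p * c * N
        ≡⟨ tangent-sum-ring₂ q c w m t p N ⟩
      c * w * (q * m) + (t * (p * p) * c * N + 2 * (t * p) * p * c * N)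
        ≤⟨ +-monoˡ-≤ _ (*-monoʳ-≤ (c * w) (<⇒≤ qm<pN)) ⟩
      c * w * (p * N) + (t * (p * p) * c * N + 2 * (t * p) * p * c * N)
        ≡⟨ tangent-sum-ring₃ c w p N t ⟩
      (w + 2 * (t * p)) * p * (c * N) + t * (p * p) * c * N
        ≡⟨ cong (λ z → z * p * (c * N) + t * (p * p) * c * N) w-eq ⟩
      suc t * (q * c) * p * (c * N) + t * (p * p) * c * N ∎)))
  where
  open ≤-Reasoning
  c : ℕ
  c = k C suc t
  instance
    c*N≢0 : NonZero (c * N)
    c*N≢0 = m*n≢0 c N {{>-nonZero (1≤kCℓ k (suc t) p q bb)}}

-- Finite sums

private variable
  A B : Set

∑ : List A → (A → ℕ) → ℕ
∑ xs f = sum (map f xs)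

∑-cong : ∀ {f g : A → ℕ} → (∀ x → f x ≡ g x) → ∀ xs → ∑ xs f ≡ ∑ xs g
∑-cong f≡g []       = refl
∑-cong f≡g (x ∷ xs) = cong₂ _+_ (f≡g x) (∑-cong f≡g xs)

∑-mono-All : ∀ {f g : A → ℕ} {xs} → All (λ x → f x ≤ g x) xs → ∑ xs f ≤ ∑ xs g
∑-mono-All []            = z≤n
∑-mono-All (fx≤gx ∷ f≤g) = +-mono-≤ fx≤gx (∑-mono-All f≤g)

∑-mono : ∀ {f g : A → ℕ} → (∀ x → f x ≤ g x) → ∀ xs → ∑ xs f ≤ ∑ xs g
∑-mono f≤g xs = ∑-mono-All (All.universal f≤g xs)

∑-+ : ∀ xs (f g : A → ℕ) → ∑ xs (λ x → f x + g x) ≡ ∑ xs f + ∑ xs g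
∑-+ []       f g = refl
∑-+ (x ∷ xs) f g = trans (cong (f x + g x +_) (∑-+ xs f g)) (shuffle (f x) (g x) (∑ xs f) (∑ xs g))
  where
  shuffle : ∀ a b c d → a + b + (c + d) ≡ a + c + (b + d)
  shuffle = solve-∀

∑-*ˡ : ∀ c xs (f : A → ℕ) → ∑ xs (λ x → c * f x) ≡ c * ∑ xs f
∑-*ˡ c []       f = sym (*-zeroʳ c)
∑-*ˡ c (x ∷ xs) f = trans (cong (c * f x +_) (∑-*ˡ c xs f)) (sym (*-distribˡ-+ c (f x) (∑ xs f)))

∑-*ʳ : ∀ c xs (f : A → ℕ) → ∑ xs (λ x → f x * c) ≡ ∑ xs f * c
∑-*ʳ c xs f = trans (∑-cong (λ x → *-comm (f x) c) xs) (trans (∑-*ˡ c xs f) (*-comm c (∑ xs f)))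

∑-const : ∀ c (xs : List A) → ∑ xs (λ _ → c) ≡ length xs * c
∑-const c []       = refl
∑-const c (x ∷ xs) = cong (c +_) (∑-const c xs)

∑-swap : ∀ (xs : List A) (ys : List B) (f : A → B → ℕ) →
  ∑ xs (λ x → ∑ ys (f x)) ≡ ∑ ys (λ y → ∑ xs (λ x → f x y))
∑-swap []       ys f = trans (sym (*-zeroʳ (length ys))) (sym (∑-const 0 ys))
∑-swap (x ∷ xs) ys f = trans (cong (∑ ys (f x) +_) (∑-swap xs ys f)) (sym (∑-+ ys (f x) _))

∑-++ : ∀ xs ys (f : A → ℕ) → ∑ (xs ++ ys) f ≡ ∑ xs f + ∑ ys f
∑-++ xs ys f = trans (cong sum (map-++ f xs ys)) (sum-++ (map f xs) (map f ys))

∑-map : ∀ (h : A → B) xs (f : B → ℕ) → ∑ (map h xs) f ≡ ∑ xs (f ∘ h)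
∑-map h xs f = cong sum (sym (map-∘ xs))

∑-∈ : ∀ {xs} {x : A} (f : A → ℕ) → x ∈ xs → f x ≤ ∑ xs f
∑-∈ f (here refl)           = m≤m+n _ _
∑-∈ f (there {x = y} x∈xs) = ≤-trans (∑-∈ f x∈xs) (m≤n+m _ (f y))

-- A surplus at a single entry survives in the total. It serves to carry the extra ℓ from the type
-- of one covering rook to the sum over all types.
∑-mono-∈ : ∀ {f g : A → ℕ} {c x xs} → All (λ x → f x ≤ g x) xs → x ∈ xs → f x + c ≤ g x →
  ∑ xs f + c ≤ ∑ xs g
∑-mono-∈ {f = f} {g} {c} {x} {_ ∷ xs} (_ ∷ f≤g) (here refl) fx+c≤gx = begin
  f x + ∑ xs f + c ≡⟨ shuffle (f x) (∑ xs f) c ⟩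
  f x + c + ∑ xs f ≤⟨ +-mono-≤ fx+c≤gx (∑-mono-All f≤g) ⟩
  g x + ∑ xs g     ∎
  where
  open ≤-Reasoning
  shuffle : ∀ a b c → a + b + c ≡ a + c + b
  shuffle = solve-∀
∑-mono-∈ {f = f} {g} {c} {x} {y ∷ xs} (fy≤gy ∷ f≤g) (there x∈xs) fx+c≤gx = begin
  f y + ∑ xs f + c   ≡⟨ +-assoc (f y) (∑ xs f) c ⟩
  f y + (∑ xs f + c) ≤⟨ +-mono-≤ fy≤gy (∑-mono-∈ f≤g x∈xs fx+c≤gx) ⟩
  g y + ∑ xs g       ∎
  where open ≤-Reasoning

∑-cartesianProductWith : ∀ {C : Set} (h : A → B → C) xs ys (f : C → ℕ) →
  ∑ (cartesianProductWith h xs ys) f ≡ ∑ xs (λ x → ∑ ys (λ y → f (h x y)))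
∑-cartesianProductWith h []       ys f = refl
∑-cartesianProductWith h (x ∷ xs) ys f =
  trans (∑-++ (map (h x) ys) (cartesianProductWith h xs ys) f)
    (cong₂ _+_ (∑-map (h x) ys f) (∑-cartesianProductWith h xs ys f))

module Indicator (_≟_ : DecidableEquality A) where

  δ : A → A → ℕ
  δ x y with x ≟ y
  ... | yes _ = 1
  ... | no  _ = 0

  δ-refl : ∀ x → δ x x ≡ 1
  δ-refl x with x ≟ x
  ... | yes _   = refl
  ... | no  x≢x = ⊥-elim (x≢x refl)

  ∑-δ≡0 : ∀ x {ys} → All (x ≢_) ys → ∑ ys (δ x) ≡ 0
  ∑-δ≡0 x []                     = refl
  ∑-δ≡0 x {y ∷ _} (x≢y ∷ x∉ys) with x ≟ y
  ... | yes x≡y = ⊥-elim (x≢y x≡y)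
  ... | no  _   = ∑-δ≡0 x x∉ys

  ∑-δ≤1 : ∀ x {ys} → Unique ys → ∑ ys (δ x) ≤ 1
  ∑-δ≤1 x []              = z≤n
  ∑-δ≤1 x {y ∷ _} (y∉ys ∷ u) with x ≟ y
  ... | yes refl = s≤s (≤-reflexive (∑-δ≡0 x y∉ys))
  ... | no  _    = ∑-δ≤1 x u

-- Sums over unordered pairs of list entries

pairs : List A → List (A × A)
pairs []       = []
pairs (x ∷ xs) = map (x ,_) xs ++ pairs xs

All-pairs : ∀ {xs : List A} → Unique xs → All (uncurry _≢_) (pairs xs)
All-pairs []         = []
All-pairs (x∉xs ∷ u) = All.++⁺ (All.map⁺ x∉xs) (All-pairs u)

∑-pairs : ∀ x xs (f : A × A → ℕ) → ∑ (pairs (x ∷ xs)) f ≡ ∑ xs (λ y → f (x , y)) + ∑ (pairs xs) f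
∑-pairs x xs f = trans (∑-++ (map (x ,_) xs) (pairs xs) f) (cong (_+ ∑ (pairs xs) f) (∑-map (x ,_) xs f))

2*length-pairs : ∀ (xs : List A) → 2 * length (pairs xs) + length xs ≡ length xs * length xs
2*length-pairs []       = refl
2*length-pairs (x ∷ xs) = begin
  2 * length (pairs (x ∷ xs)) + suc m       ≡⟨ cong (λ z → 2 * z + suc m) (trans (length-++ (map (x ,_) xs)) (cong (_+ length (pairs xs)) (length-map (x ,_) xs))) ⟩
  2 * (m + length (pairs xs)) + suc m       ≡⟨ e₁ m (length (pairs xs)) ⟩
  2 * m + 1 + (2 * length (pairs xs) + m)   ≡⟨ cong (2 * m + 1 +_) (2*length-pairs xs) ⟩
  2 * m + 1 + m * m                         ≡⟨ e₂ m ⟩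
  suc m * suc m                             ∎
  where
  open ≡-Reasoning
  m : ℕ
  m = length xs
  e₁ : ∀ m l → 2 * (m + l) + suc m ≡ 2 * m + 1 + (2 * l + m)
  e₁ = solve-∀
  e₂ : ∀ m → 2 * m + 1 + m * m ≡ suc m * suc m
  e₂ = solve-∀

-- Each entry occurs in m - 1 pairs, where m is the length; the extra sum on the left replaces the
-- subtraction.
∑-pairs-+ : ∀ xs (f : A → ℕ) →
  ∑ (pairs xs) (λ (x , y) → f x + f y) + ∑ xs f ≡ length xs * ∑ xs f
∑-pairs-+ []       f = refl
∑-pairs-+ (x ∷ xs) f = begin
  ∑ (pairs (x ∷ xs)) F + (f x + s)        ≡⟨ cong (_+ (f x + s)) (∑-pairs x xs F) ⟩
  ∑ xs (λ y → f x + f y) + ∑ (pairs xs) F + (f x + s)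
    ≡⟨ cong (λ z → z + ∑ (pairs xs) F + (f x + s)) (trans (∑-+ xs (λ _ → f x) f) (cong (_+ s) (∑-const (f x) xs))) ⟩
  m * f x + s + ∑ (pairs xs) F + (f x + s) ≡⟨ e₁ m (f x) s (∑ (pairs xs) F) ⟩
  suc m * f x + s + (∑ (pairs xs) F + s)  ≡⟨ cong (suc m * f x + s +_) (∑-pairs-+ xs f) ⟩
  suc m * f x + s + m * s                 ≡⟨ e₂ m (f x) s ⟩
  suc m * (f x + s)                       ∎
  where
  open ≡-Reasoning
  m s : ℕ
  m = length xs
  s = ∑ xs f
  F : _ → ℕ
  F (x , y) = f x + f y
  e₁ : ∀ m a s P → m * a + s + P + (a + s) ≡ suc m * a + s + (P + s)
  e₁ = solve-∀
  e₂ : ∀ m a s → suc m * a + s + m * s ≡ suc m * (a + s)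
  e₂ = solve-∀

-- Expanding the square of the sum leaves the diagonal terms f x * f x, which equal f x because f
-- takes only the values 0 and 1.
∑-pairs-* : ∀ xs (f : A → ℕ) → (∀ x → f x * f x ≡ f x) →
  2 * ∑ (pairs xs) (λ (x , y) → f x * f y) + ∑ xs f ≡ ∑ xs f * ∑ xs f
∑-pairs-* []       f idem = refl
∑-pairs-* (x ∷ xs) f idem = begin
  2 * ∑ (pairs (x ∷ xs)) F + (f x + s)
    ≡⟨ cong (λ z → 2 * z + (f x + s)) (trans (∑-pairs x xs F) (cong (_+ ∑ (pairs xs) F) (∑-*ˡ (f x) xs f))) ⟩
  2 * (f x * s + ∑ (pairs xs) F) + (f x + s)
    ≡⟨ e₁ (f x) s (∑ (pairs xs) F) ⟩
  2 * (f x * s) + f x + (2 * ∑ (pairs xs) F + s)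
    ≡⟨ cong₂ (λ y z → 2 * (f x * s) + y + z) (sym (idem x)) (∑-pairs-* xs f idem) ⟩
  2 * (f x * s) + f x * f x + s * s
    ≡⟨ e₂ (f x) s ⟩
  (f x + s) * (f x + s) ∎
  where
  open ≡-Reasoning
  s : ℕ
  s = ∑ xs f
  F : _ → ℕ
  F (x , y) = f x * f y
  e₁ : ∀ a s P → 2 * (a * s + P) + (a + s) ≡ 2 * (a * s) + a + (2 * P + s)
  e₁ = solve-∀
  e₂ : ∀ a s → 2 * (a * s) + a * a + s * s ≡ (a + s) * (a + s)
  e₂ = solve-∀

-- Sums over the points of the cube

length-allFin : ∀ n → length (allFin n) ≡ n
length-allFin n = length-tabulate {n = n} id

∑-allFin-const : ∀ n c → ∑ (allFin n) (λ _ → c) ≡ n * c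
∑-allFin-const n c = trans (∑-const c (allFin n)) (cong (_* c) (length-allFin n))

points : ∀ n k → List (Vec (Fin n) k)
points n zero    = [] ∷ []
points n (suc k) = cartesianProductWith _∷_ (allFin n) (points n k)

length-points : ∀ n k → length (points n k) ≡ n ^ k
length-points n zero    = refl
length-points n (suc k) = begin
  length (points n (suc k))                        ≡⟨ *-identityʳ _ ⟨
  length (points n (suc k)) * 1                    ≡⟨ ∑-const 1 (points n (suc k)) ⟨
  ∑ (points n (suc k)) (λ _ → 1)                   ≡⟨ ∑-cartesianProductWith _∷_ (allFin n) (points n k) (λ _ → 1) ⟩
  ∑ (allFin n) (λ _ → ∑ (points n k) (λ _ → 1))    ≡⟨ ∑-allFin-const n _ ⟩
  n * ∑ (points n k) (λ _ → 1)                     ≡⟨ cong (n *_) (trans (∑-const 1 (points n k)) (*-identityʳ _)) ⟩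
  n * length (points n k)                          ≡⟨ cong (n *_) (length-points n k) ⟩
  n * n ^ k                                        ∎
  where open ≡-Reasoning

-- Summing over Q and then along the line through Q in direction i counts each point once for every
-- point of its own line, hence n times.
∑-points-update : ∀ {n k} (i : Fin k) (f : Vec (Fin n) k → ℕ) →
  ∑ (points n k) (λ Q → ∑ (allFin n) (λ x → f (Q [ i ]≔ x))) ≡ n * ∑ (points n k) f
∑-points-update {n} {suc k} zero f = begin
  ∑ (points n (suc k)) (λ Q → ∑ (allFin n) (λ x → f (Q [ zero ]≔ x)))
    ≡⟨ ∑-cartesianProductWith _∷_ (allFin n) (points n k) _ ⟩
  ∑ (allFin n) (λ _ → ∑ (points n k) (λ Q → ∑ (allFin n) (λ x → f (x ∷ Q))))
    ≡⟨ ∑-allFin-const n _ ⟩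
  n * ∑ (points n k) (λ Q → ∑ (allFin n) (λ x → f (x ∷ Q)))
    ≡⟨ cong (n *_) (∑-swap (points n k) (allFin n) _) ⟩
  n * ∑ (allFin n) (λ x → ∑ (points n k) (λ Q → f (x ∷ Q)))
    ≡⟨ cong (n *_) (∑-cartesianProductWith _∷_ (allFin n) (points n k) f) ⟨
  n * ∑ (points n (suc k)) f ∎
  where open ≡-Reasoning
∑-points-update {n} {suc k} (suc i) f = begin
  ∑ (points n (suc k)) (λ Q → ∑ (allFin n) (λ x → f (Q [ suc i ]≔ x)))
    ≡⟨ ∑-cartesianProductWith _∷_ (allFin n) (points n k) _ ⟩
  ∑ (allFin n) (λ y → ∑ (points n k) (λ Q → ∑ (allFin n) (λ x → f (y ∷ Q [ i ]≔ x))))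
    ≡⟨ ∑-cong (λ y → ∑-points-update i (λ Q → f (y ∷ Q))) (allFin n) ⟩
  ∑ (allFin n) (λ y → n * ∑ (points n k) (λ Q → f (y ∷ Q)))
    ≡⟨ ∑-*ˡ n (allFin n) _ ⟩
  n * ∑ (allFin n) (λ y → ∑ (points n k) (λ Q → f (y ∷ Q)))
    ≡⟨ cong (n *_) (∑-cartesianProductWith _∷_ (allFin n) (points n k) f) ⟨
  n * ∑ (points n (suc k)) f ∎
  where open ≡-Reasoning

-- Occupied lines and planes

Unique-points : ∀ n k → Unique (points n k)
Unique-points n zero    = [] ∷ []
Unique-points n (suc k) = Unique.cartesianProductWith⁺ _∷_ ∷-injective (Unique.allFin⁺ n) (Unique-points n k)

directions : ∀ {k} → Subset k → List (Fin k)
directions []            = []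
directions (inside  ∷ D) = zero ∷ map suc (directions D)
directions (outside ∷ D) = map suc (directions D)

length-directions : ∀ {k} (D : Subset k) → length (directions D) ≡ ∣ D ∣
length-directions []            = refl
length-directions (inside  ∷ D) = cong suc (trans (length-map suc (directions D)) (length-directions D))
length-directions (outside ∷ D) = trans (length-map suc (directions D)) (length-directions D)

∈-directions : ∀ {k} {D : Subset k} {i} → i ∈ₛ D → i ∈ directions D
∈-directions {D = inside  ∷ D} here        = here refl
∈-directions {D = inside  ∷ D} (there i∈D) = there (∈-map⁺ suc (∈-directions i∈D))
∈-directions {D = outside ∷ D} (there i∈D) = ∈-map⁺ suc (∈-directions i∈D)

Unique-directions : ∀ {k} (D : Subset k) → Unique (directions D)
Unique-directions []            = []
Unique-directions (inside  ∷ D) =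
  All.map⁺ (All.universal (λ _ ()) (directions D)) ∷ Unique.map⁺ Fin.suc-injective (Unique-directions D)
Unique-directions (outside ∷ D) = Unique.map⁺ Fin.suc-injective (Unique-directions D)

-- Built along Pascal's rule, so that its length is `k C ℓ` by the same recursion.
subsets : ∀ k → ℕ → List (Subset k)
subsets zero    zero    = [] ∷ []
subsets zero    (suc ℓ) = []
subsets (suc k) zero    = map (outside ∷_) (subsets k zero)
subsets (suc k) (suc ℓ) = map (inside ∷_) (subsets k ℓ) ++ map (outside ∷_) (subsets k (suc ℓ))

length-subsets : ∀ k ℓ → length (subsets k ℓ) ≡ k C ℓ
length-subsets zero    zero    = refl
length-subsets zero    (suc ℓ) = refl
length-subsets (suc k) zero    = trans (length-map _ (subsets k zero)) (trans (length-subsets k zero) (trans (nC0≡1 k) (sym (nC0≡1 (suc k)))))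
  where
  nC0≡1 : ∀ n → n C 0 ≡ 1
  nC0≡1 n = trans (nCk≡nC[n∸k] {k = 0} {n = n} z≤n) (nCn≡1 n)
length-subsets (suc k) (suc ℓ) = begin
  length (map (inside ∷_) (subsets k ℓ) ++ map (outside ∷_) (subsets k (suc ℓ)))
    ≡⟨ length-++ (map (inside ∷_) (subsets k ℓ)) ⟩
  length (map (inside ∷_) (subsets k ℓ)) + length (map (outside ∷_) (subsets k (suc ℓ)))
    ≡⟨ cong₂ _+_ (length-map _ (subsets k ℓ)) (length-map _ (subsets k (suc ℓ))) ⟩
  length (subsets k ℓ) + length (subsets k (suc ℓ))
    ≡⟨ cong₂ _+_ (length-subsets k ℓ) (length-subsets k (suc ℓ)) ⟩
  k C ℓ + k C suc ℓ
    ≡⟨ nCk+nC[k+1]≡[n+1]C[k+1] k ℓ ⟩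
  suc k C suc ℓ ∎
  where open ≡-Reasoning

∈-subsets : ∀ {k} (D : Subset k) → D ∈ subsets k ∣ D ∣
∈-subsets []            = here refl
∈-subsets (inside  ∷ D) = ∈-++⁺ˡ (∈-map⁺ (inside ∷_) (∈-subsets D))
∈-subsets (outside ∷ D) with ∣ D ∣ | ∈-subsets D
... | zero  | D∈ = ∈-map⁺ (outside ∷_) D∈
... | suc ℓ | D∈ = ∈-++⁺ʳ (map (inside ∷_) (subsets _ ℓ)) (∈-map⁺ (outside ∷_) D∈)

size-subsets : ∀ k ℓ → All (λ D → ∣ D ∣ ≡ ℓ) (subsets k ℓ)
size-subsets zero    zero    = refl ∷ []
size-subsets zero    (suc ℓ) = []
size-subsets (suc k) zero    = All.map⁺ (size-subsets k zero)
size-subsets (suc k) (suc ℓ) =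
  All.++⁺ (All.map⁺ (All.map (cong suc) (size-subsets k ℓ))) (All.map⁺ (size-subsets k (suc ℓ)))

Unique-subsets : ∀ k ℓ → Unique (subsets k ℓ)
Unique-subsets zero    zero    = [] ∷ []
Unique-subsets zero    (suc ℓ) = []
Unique-subsets (suc k) zero    = Unique.map⁺ (proj₂ ∘ ∷-injective) (Unique-subsets k zero)
Unique-subsets (suc k) (suc ℓ) = Unique.++⁺
  (Unique.map⁺ (proj₂ ∘ ∷-injective) (Unique-subsets k ℓ))
  (Unique.map⁺ (proj₂ ∘ ∷-injective) (Unique-subsets k (suc ℓ)))
  λ (∈ins , ∈out) → disjoint (∈-map⁻ _ ∈ins) (∈-map⁻ _ ∈out)
  where
  disjoint : ∀ {v : Subset (suc k)} → ∃[ D ] (D ∈ subsets k ℓ × v ≡ inside ∷ D) →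
    ∃[ D ] (D ∈ subsets k (suc ℓ) × v ≡ outside ∷ D) → ⊥
  disjoint (_ , _ , refl) (_ , _ , ())

1⊓-idem : ∀ m → (1 ⊓ m) * (1 ⊓ m) ≡ 1 ⊓ m
1⊓-idem zero    = refl
1⊓-idem (suc m) = refl

module _ {n : ℕ} (χ : Fin n → Fin n → ℕ) where

  column row : Fin n → ℕ
  column y = 1 ⊓ ∑ (allFin n) (λ x → χ x y)
  row x    = 1 ⊓ ∑ (allFin n) (χ x)

  private
    columns rows total : ℕ
    columns = ∑ (allFin n) column
    rows    = ∑ (allFin n) row
    total   = ∑ (allFin n) (λ x → ∑ (allFin n) (χ x))

  ∑-1⊓≤n : ∀ (f : Fin n → ℕ) → ∑ (allFin n) (λ x → 1 ⊓ f x) ≤ n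
  ∑-1⊓≤n f = ≤-trans (∑-mono (λ x → m⊓n≤m 1 (f x)) (allFin n))
    (≤-reflexive (trans (∑-allFin-const n 1) (*-identityʳ n)))

  columns≤total : columns ≤ total
  columns≤total = ≤-trans (∑-mono (λ y → m⊓n≤n 1 _) (allFin n)) (≤-reflexive (∑-swap (allFin n) (allFin n) _))

  rows≤total : rows ≤ total
  rows≤total = ∑-mono (λ x → m⊓n≤n 1 _) (allFin n)

  -- Let A and B be the numbers of occupied columns and rows and M the total of χ. Over the n²
  -- cells, `column y + row x` sums to n (A + B), the product `column y * row x` to A B, and
  -- `n * χ x y` to n M. The two sides are therefore those of `bound` at A, B, M, now in a form that
  -- can be summed over points.
  ∑-grid : ∀ {α γ δ κ} →
    (∀ A B M → A ≤ M → B ≤ M → A ≤ n → B ≤ n → κ * (n * (A + B)) ≤ α * (A * B) + γ * (n * M) + δ * (n * n)) →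
    ∑ (allFin n) (λ x → ∑ (allFin n) (λ y → κ * (column y + row x)))
      ≤ ∑ (allFin n) (λ x → ∑ (allFin n) (λ y → α * (column y * row x) + γ * (n * χ x y) + δ))
  ∑-grid {α} {γ} {δ} {κ} bound = begin
    ∑F (λ x → ∑F (λ y → κ * (column y + row x)))
      ≡⟨ ∑-cong (λ x → trans (∑-*ˡ κ (allFin n) _) (cong (κ *_)
           (trans (∑-+ (allFin n) column _) (cong (columns +_) (∑-allFin-const n (row x)))))) (allFin n) ⟩
    ∑F (λ x → κ * (columns + n * row x))
      ≡⟨ trans (∑-*ˡ κ (allFin n) _) (cong (κ *_)
           (trans (∑-+ (allFin n) _ _) (cong₂ _+_ (∑-allFin-const n columns) (∑-*ˡ n (allFin n) row)))) ⟩
    κ * (n * columns + n * rows)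
      ≡⟨ cong (κ *_) (*-distribˡ-+ n columns rows) ⟨
    κ * (n * (columns + rows))
      ≤⟨ bound columns rows total columns≤total rows≤total (∑-1⊓≤n _) (∑-1⊓≤n _) ⟩
    α * (columns * rows) + γ * (n * total) + δ * (n * n)
      ≡⟨ cong₂ _+_ (cong₂ _+_
           (trans (∑-*ˡ α (allFin n) _) (cong (α *_) (∑-*ˡ columns (allFin n) row)))
           (trans (∑-*ˡ γ (allFin n) _) (cong (γ *_) (∑-*ˡ n (allFin n) _))))
           (trans (∑-allFin-const n (n * δ)) (rearrange n δ)) ⟨
    ∑F (λ x → α * (columns * row x)) + ∑F (λ x → γ * (n * ∑F (χ x))) + ∑F (λ _ → n * δ)
      ≡⟨ trans (∑-+ (allFin n) _ _) (cong (_+ ∑F (λ _ → n * δ)) (∑-+ (allFin n) _ _)) ⟨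
    ∑F (λ x → α * (columns * row x) + γ * (n * ∑F (χ x)) + n * δ)
      ≡⟨ ∑-cong (λ x → cong₂ _+_ (cong₂ _+_
           (trans (∑-*ˡ α (allFin n) _) (cong (α *_) (∑-*ʳ (row x) (allFin n) column)))
           (trans (∑-*ˡ γ (allFin n) _) (cong (γ *_) (∑-*ˡ n (allFin n) (χ x)))))
           (∑-allFin-const n δ)) (allFin n) ⟨
    ∑F (λ x → ∑F (λ y → α * (column y * row x)) + ∑F (λ y → γ * (n * χ x y)) + ∑F (λ _ → δ))
      ≡⟨ ∑-cong (λ x → trans (∑-+ (allFin n) _ _) (cong (_+ ∑F (λ _ → δ)) (∑-+ (allFin n) _ _))) (allFin n) ⟨
    ∑F (λ x → ∑F (λ y → α * (column y * row x) + γ * (n * χ x y) + δ)) ∎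
    where
    open ≤-Reasoning
    ∑F : (Fin n → ℕ) → ℕ
    ∑F = ∑ (allFin n)
    rearrange : ∀ n δ → n * (n * δ) ≡ δ * (n * n)
    rearrange = solve-∀

∑-points-update₂ : ∀ {n k} (i j : Fin k) (f : Vec (Fin n) k → ℕ) →
  ∑ (points n k) (λ Q → ∑ (allFin n) (λ x → ∑ (allFin n) (λ y → f (Q [ i ]≔ x [ j ]≔ y))))
    ≡ n * (n * ∑ (points n k) f)
∑-points-update₂ {n} i j f =
  trans (∑-points-update i (λ Q → ∑ (allFin n) (λ y → f (Q [ j ]≔ y)))) (cong (n *_) (∑-points-update j f))

private
  covered-ring₁ : ∀ t p s w L E X → 2 * (t * (s * s)) * E + L * (2 * (s * w) * X) + L * (2 * (t * (p * p)))
    ≡ t * (s * s * (2 * E)) + 2 * L * (s * w * X + t * (p * p))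
  covered-ring₁ = solve-∀
  covered-ring₂ : ∀ t p s w E X → t * (s * s * (2 * E)) + suc t * t * (s * w * X + t * (p * p))
    ≡ t * (s * s * (2 * E) + suc t * (s * w) * X + suc t * (t * (p * p)))
  covered-ring₂ = solve-∀

module Occupation {n k : ℕ} (χ : Point n k → ℕ) where

  -- Cutting the count off at 1 gives the indicator that the line through Q in direction i is
  -- occupied.
  occ : Fin k → Point n k → ℕ
  occ i Q = 1 ⊓ ∑ (allFin n) (λ x → χ (Q [ i ]≔ x))

  ∑-occ≤ : ∀ i → ∑ (points n k) (occ i) ≤ n * ∑ (points n k) χ
  ∑-occ≤ i = ≤-trans (∑-mono (λ Q → m⊓n≤n 1 _) (points n k)) (≤-reflexive (∑-points-update i χ))

  module _ .{{_ : NonZero n}} {i j : Fin k} (i≢j : i ≢ j) {α γ δ κ : ℕ}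
    (bound : ∀ A B M → A ≤ M → B ≤ M → A ≤ n → B ≤ n →
       κ * (n * (A + B)) ≤ α * (A * B) + γ * (n * M) + δ * (n * n)) where

    private
      lhs rhs : Point n k → ℕ
      lhs Q = κ * (occ i Q + occ j Q)
      rhs Q = α * (occ i Q * occ j Q) + γ * (n * χ Q) + δ

    -- On the (i, j)-plane through Q, `occ i` depends only on the j-coordinate and `occ j` only on
    -- the i-coordinate, so `∑-grid` applies to the restriction ψ of χ to this plane.
    ∑-plane : ∀ Q →
      ∑ (allFin n) (λ x → ∑ (allFin n) (λ y → lhs (Q [ i ]≔ x [ j ]≔ y)))
        ≤ ∑ (allFin n) (λ x → ∑ (allFin n) (λ y → rhs (Q [ i ]≔ x [ j ]≔ y)))
    ∑-plane Q = begin
      ∑ (allFin n) (λ x → ∑ (allFin n) (λ y → lhs (P x y)))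
        ≡⟨ ∑-cong (λ x → ∑-cong (λ y → cong₂ (λ a b → κ * (a + b)) (occ-i x y) (occ-j x y)) (allFin n)) (allFin n) ⟩
      ∑ (allFin n) (λ x → ∑ (allFin n) (λ y → κ * (column ψ y + row ψ x)))
        ≤⟨ ∑-grid ψ {α} {γ} {δ} {κ} bound ⟩
      ∑ (allFin n) (λ x → ∑ (allFin n) (λ y → α * (column ψ y * row ψ x) + γ * (n * ψ x y) + δ))
        ≡⟨ ∑-cong (λ x → ∑-cong (λ y → cong₂ (λ a b → α * (a * b) + γ * (n * ψ x y) + δ)
             (occ-i x y) (occ-j x y)) (allFin n)) (allFin n) ⟨
      ∑ (allFin n) (λ x → ∑ (allFin n) (λ y → rhs (P x y))) ∎
      where
      open ≤-Reasoning
      P : Fin n → Fin n → Point n k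
      P x y = Q [ i ]≔ x [ j ]≔ y
      ψ : Fin n → Fin n → ℕ
      ψ x y = χ (P x y)
      occ-i : ∀ x y → occ i (P x y) ≡ column ψ y
      -- The new update in direction i has to pass the one in direction j before it can absorb the
      -- old one; this is where i and j must differ.
      occ-i x y = cong (1 ⊓_) (∑-cong (λ x′ → cong χ
        (trans ([]≔-commutes (Q [ i ]≔ x) j i (i≢j ∘ sym)) (cong (_[ j ]≔ y) ([]≔-idempotent Q i)))) (allFin n))
      occ-j : ∀ x y → occ j (P x y) ≡ row ψ x
      occ-j x y = cong (1 ⊓_) (∑-cong (λ y′ → cong χ ([]≔-idempotent (Q [ i ]≔ x) j)) (allFin n))

    -- Summing `∑-plane` over Q counts every point n² times on both sides, and n² cancels since n >
    -- 0.
    ∑-occ-pair : ∑ (points n k) lhs ≤ ∑ (points n k) rhs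
    ∑-occ-pair = *-cancelˡ-≤ n (*-cancelˡ-≤ n (begin
      n * (n * ∑ (points n k) lhs)
        ≡⟨ ∑-points-update₂ i j lhs ⟨
      ∑ (points n k) (λ Q → ∑ (allFin n) (λ x → ∑ (allFin n) (λ y → lhs (Q [ i ]≔ x [ j ]≔ y))))
        ≤⟨ ∑-mono ∑-plane (points n k) ⟩
      ∑ (points n k) (λ Q → ∑ (allFin n) (λ x → ∑ (allFin n) (λ y → rhs (Q [ i ]≔ x [ j ]≔ y))))
        ≡⟨ ∑-points-update₂ i j rhs ⟩
      n * (n * ∑ (points n k) rhs) ∎))
      where open ≤-Reasoning

  -- If `is` lists the elements of D and χ counts the rooks of type D, then `covered` is S_D(Q), and
  -- twice `overlaps` is S_D(Q) (S_D(Q) - 1).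
  covered overlaps : List (Fin k) → Point n k → ℕ
  covered is Q = ∑ is (λ i → occ i Q)
  overlaps is Q = ∑ (pairs is) (λ (i , j) → occ i Q * occ j Q)

  overlaps-covered : ∀ is Q → 2 * overlaps is Q + covered is Q ≡ covered is Q * covered is Q
  overlaps-covered is Q = ∑-pairs-* is (λ i → occ i Q) (λ i → 1⊓-idem _)

  covered≤length : ∀ is Q → covered is Q ≤ length is
  covered≤length is Q = ≤-trans (∑-mono (λ i → m⊓n≤m 1 _) is) (≤-reflexive (trans (∑-const 1 is) (*-identityʳ _)))

  -- This is S (S - 1) ≤ ℓ S, which includes the types with S = 0, where the sharper estimate with
  -- the surplus ℓ fails for ℓ > 0.
  overlaps≤ : ∀ is Q → 2 * overlaps is Q ≤ length is * covered is Q
  overlaps≤ is Q = begin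
    2 * overlaps is Q                ≤⟨ m≤m+n _ _ ⟩
    2 * overlaps is Q + covered is Q ≡⟨ overlaps-covered is Q ⟩
    covered is Q * covered is Q     ≤⟨ *-monoˡ-≤ (covered is Q) (covered≤length is Q) ⟩
    length is * covered is Q        ∎
    where open ≤-Reasoning

  -- Writing S for `covered is Q` and ℓ for the length of `is`, the claim is S² - S + ℓ ≤ ℓ S, that
  -- is (S - 1) (ℓ - S) ≥ 0.
  overlaps+length≤ : ∀ is Q → 1 ≤ covered is Q → 2 * overlaps is Q + length is ≤ length is * covered is Q
  overlaps+length≤ is Q 1≤S with covered is Q | overlaps-covered is Q | covered≤length is Q
  overlaps+length≤ is Q (s≤s _) | S@(suc r) | 2E+S≡S² | S≤ℓ =
    +-cancelʳ-≤ S _ _ (begin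
      2 * overlaps is Q + length is + S   ≡⟨ e₁ (overlaps is Q) (length is) S ⟩
      2 * overlaps is Q + S + length is   ≡⟨ cong (_+ length is) 2E+S≡S² ⟩
      S * S + length is                  ≡⟨ e₂ r (length is) ⟩
      r * S + S + length is              ≤⟨ +-monoˡ-≤ (length is) (+-monoˡ-≤ S (*-monoʳ-≤ r S≤ℓ)) ⟩
      r * length is + S + length is      ≡⟨ e₃ r (length is) ⟩
      length is * S + S                  ∎)
    where
    open ≤-Reasoning
    e₁ : ∀ E ℓ S → 2 * E + ℓ + S ≡ 2 * E + S + ℓ
    e₁ = solve-∀
    e₂ : ∀ r ℓ → suc r * suc r + ℓ ≡ r * suc r + suc r + ℓ
    e₂ = solve-∀
    e₃ : ∀ r ℓ → r * ℓ + suc r + ℓ ≡ ℓ * suc r + suc r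
    e₃ = solve-∀

  module _ .{{_ : NonZero n}} (t p s w : ℕ) (tp≤s : t * p ≤ s) (w-eq : w + 2 * (t * p) ≡ suc t * s) where

    -- For t ≥ 1 this is the sum of `∑-occ-pair`, with the coefficients from `tangent`, over the ℓ t
    -- / 2 pairs of directions, divided by t. For t = 0 there are no pairs and w = s; the claim then
    -- only says that an occupied line contains at least one rook.
    ∑-covered≤ : ∀ is → Unique is → length is ≡ suc t →
      ∑ (points n k) (λ Q → suc t * (s * s) * covered is Q)
        ≤ ∑ (points n k) (λ Q →
            s * s * (2 * overlaps is Q) + suc t * (s * w) * (n * χ Q) + suc t * (t * (p * p)))
    ∑-covered≤ = go t refl
      where
      open ≤-Reasoning
      go : ∀ t′ → t ≡ t′ → ∀ is → Unique is → length is ≡ suc t →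
        ∑ (points n k) (λ Q → suc t * (s * s) * covered is Q)
          ≤ ∑ (points n k) (λ Q →
              s * s * (2 * overlaps is Q) + suc t * (s * w) * (n * χ Q) + suc t * (t * (p * p)))
      go zero refl (i ∷ []) _ _ = begin
        ∑ (points n k) (λ Q → 1 * (s * s) * (occ i Q + 0))
          ≡⟨ ∑-*ˡ (1 * (s * s)) (points n k) _ ⟩
        1 * (s * s) * ∑ (points n k) (λ Q → occ i Q + 0)
          ≡⟨ cong (1 * (s * s) *_) (∑-cong (λ Q → +-identityʳ (occ i Q)) (points n k)) ⟩
        1 * (s * s) * ∑ (points n k) (occ i)
          ≤⟨ *-monoʳ-≤ (1 * (s * s)) (∑-occ≤ i) ⟩
        1 * (s * s) * (n * ∑ (points n k) χ)
          ≡⟨ cong (λ z → 1 * (s * z) * (n * ∑ (points n k) χ)) w≡s ⟨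
        1 * (s * w) * (n * ∑ (points n k) χ)
          ≡⟨ trans (∑-*ˡ (1 * (s * w)) (points n k) _) (cong (1 * (s * w) *_) (∑-*ˡ n (points n k) χ)) ⟨
        ∑ (points n k) (λ Q → 1 * (s * w) * (n * χ Q))
          ≤⟨ ∑-mono (λ Q → ≤-trans (m≤n+m _ (s * s * (2 * 0))) (m≤m+n _ _)) (points n k) ⟩
        ∑ (points n k) (λ Q → s * s * (2 * 0) + 1 * (s * w) * (n * χ Q) + 1 * (0 * (p * p))) ∎
        where
        w≡s : w ≡ s
        w≡s = trans (sym (+-identityʳ w)) (trans w-eq (+-identityʳ s))
      -- Each of the ℓ directions lies in t pairs and 2 L = ℓ t, so a factor t comes out of both
      -- sides.
      go (suc r) refl is unique len = *-cancelˡ-≤ t (begin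
        t * ∑ (points n k) (λ Q → κ * covered is Q)
          ≡⟨ ∑-*ˡ t (points n k) _ ⟨
        ∑ (points n k) (λ Q → t * (κ * covered is Q))
          ≡⟨ ∑-cong lhs (points n k) ⟨
        ∑ (points n k) (λ Q → ∑ (pairs is) (λ (i , j) → κ * (occ i Q + occ j Q)))
          ≡⟨ ∑-swap (points n k) (pairs is) _ ⟩
        ∑ (pairs is) (λ (i , j) → ∑ (points n k) (λ Q → κ * (occ i Q + occ j Q)))
          ≤⟨ ∑-mono-All (All.map (λ i≢j → ∑-occ-pair i≢j {α} {γ} {δ} {κ} (tangent t p s w n (s≤s z≤n) tp≤s w-eq))
               (All-pairs unique)) ⟩
        ∑ (pairs is) (λ (i , j) → ∑ (points n k) (λ Q → α * (occ i Q * occ j Q) + γ * (n * χ Q) + δ))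
          ≡⟨ ∑-swap (points n k) (pairs is) _ ⟨
        ∑ (points n k) (λ Q → ∑ (pairs is) (λ (i , j) → α * (occ i Q * occ j Q) + γ * (n * χ Q) + δ))
          ≡⟨ ∑-cong rhs (points n k) ⟩
        ∑ (points n k) (λ Q → t * (s * s * (2 * overlaps is Q) + suc t * (s * w) * (n * χ Q) + suc t * (t * (p * p))))
          ≡⟨ ∑-*ˡ t (points n k) _ ⟩
        t * ∑ (points n k) (λ Q → s * s * (2 * overlaps is Q) + suc t * (s * w) * (n * χ Q) + suc t * (t * (p * p))) ∎)
        where
        α γ δ κ L : ℕ
        α = 2 * (t * (s * s))
        γ = 2 * (s * w)
        δ = 2 * (t * (p * p))
        κ = suc t * (s * s)
        L = length (pairs is)
        2L≡ : 2 * L ≡ suc t * t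
        2L≡ = +-cancelʳ-≡ (suc t) _ _ (trans (subst (λ z → 2 * L + z ≡ z * z) len (2*length-pairs is)) (square t))
          where
          square : ∀ t → suc t * suc t ≡ suc t * t + suc t
          square = solve-∀
        lhs : ∀ Q → ∑ (pairs is) (λ (i , j) → κ * (occ i Q + occ j Q)) ≡ t * (κ * covered is Q)
        lhs Q = begin-equality
          ∑ (pairs is) (λ (i , j) → κ * (occ i Q + occ j Q))
            ≡⟨ ∑-*ˡ κ (pairs is) _ ⟩
          κ * ∑ (pairs is) (λ (i , j) → occ i Q + occ j Q)
            ≡⟨ cong (κ *_) (+-cancelˡ-≡ (covered is Q) _ _ (trans (+-comm (covered is Q) _)
                 (trans (∑-pairs-+ is (λ i → occ i Q)) (cong (_* covered is Q) len)))) ⟩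
          κ * (t * covered is Q)
            ≡⟨ x∙yz≈y∙xz *-commutativeSemigroup κ t (covered is Q) ⟩
          t * (κ * covered is Q) ∎
        rhs : ∀ Q → ∑ (pairs is) (λ (i , j) → α * (occ i Q * occ j Q) + γ * (n * χ Q) + δ)
          ≡ t * (s * s * (2 * overlaps is Q) + suc t * (s * w) * (n * χ Q) + suc t * (t * (p * p)))
        rhs Q = begin-equality
          ∑ (pairs is) (λ (i , j) → α * (occ i Q * occ j Q) + γ * (n * χ Q) + δ)
            ≡⟨ trans (∑-+ (pairs is) _ _) (cong (_+ ∑ (pairs is) (λ _ → δ)) (∑-+ (pairs is) _ _)) ⟩
          ∑ (pairs is) (λ (i , j) → α * (occ i Q * occ j Q)) + ∑ (pairs is) (λ _ → γ * (n * χ Q)) + ∑ (pairs is) (λ _ → δ)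
            ≡⟨ cong₂ _+_ (cong₂ _+_ (∑-*ˡ α (pairs is) _) (∑-const _ (pairs is))) (∑-const δ (pairs is)) ⟩
          α * overlaps is Q + L * (γ * (n * χ Q)) + L * δ
            ≡⟨ covered-ring₁ t p s w L (overlaps is Q) (n * χ Q) ⟩
          t * (s * s * (2 * overlaps is Q)) + 2 * L * (s * w * (n * χ Q) + t * (p * p))
            ≡⟨ cong (λ z → t * (s * s * (2 * overlaps is Q)) + z * (s * w * (n * χ Q) + t * (p * p))) 2L≡ ⟩
          t * (s * s * (2 * overlaps is Q)) + suc t * t * (s * w * (n * χ Q) + t * (p * p))
            ≡⟨ covered-ring₂ t p s w (overlaps is Q) (n * χ Q) ⟩
          t * (s * s * (2 * overlaps is Q) + suc t * (s * w) * (n * χ Q) + suc t * (t * (p * p))) ∎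

-- Rooks sorted by direction set

δ-dir : ∀ {k} → Subset k → Subset k → ℕ
δ-dir = Indicator.δ (≡-dec Bool._≟_)

δ-pos : ∀ {n k} → Point n k → Point n k → ℕ
δ-pos = Indicator.δ (≡-dec Fin._≟_)

module _ {n k ℓ : ℕ} (Rs : List (Rook n k ℓ)) where

  -- For fixed D this is the counting function χ to which `Occupation` is applied.
  rooks : Subset k → Point n k → ℕ
  rooks D Q = ∑ Rs (λ R → δ-dir (dirs R) D * δ-pos (pos R) Q)

  1≤rooks : ∀ {R} → R ∈ Rs → 1 ≤ rooks (dirs R) (pos R)
  1≤rooks {R} R∈Rs = ≤-trans
    (≤-reflexive (sym (cong₂ _*_ (Indicator.δ-refl (≡-dec Bool._≟_) (dirs R)) (Indicator.δ-refl (≡-dec Fin._≟_) (pos R)))))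
    (∑-∈ (λ R′ → δ-dir (dirs R′) (dirs R) * δ-pos (pos R′) (pos R)) R∈Rs)

  -- Exchanging the sums leaves, for each rook, a product of two indicator sums; each is at most 1
  -- because `subsets` and `points` have no repetitions.
  ∑-rooks≤length : ∑ (subsets k ℓ) (λ D → ∑ (points n k) (rooks D)) ≤ length Rs
  ∑-rooks≤length = begin
    ∑ Ds (λ D → ∑ Ps (rooks D))
      ≡⟨ ∑-cong (λ D → ∑-swap Ps Rs _) Ds ⟩
    ∑ Ds (λ D → ∑ Rs (λ R → ∑ Ps (λ Q → δ-dir (dirs R) D * δ-pos (pos R) Q)))
      ≡⟨ ∑-swap Ds Rs _ ⟩
    ∑ Rs (λ R → ∑ Ds (λ D → ∑ Ps (λ Q → δ-dir (dirs R) D * δ-pos (pos R) Q)))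
      ≡⟨ ∑-cong (λ R → trans (∑-cong (λ D → ∑-*ˡ (δ-dir (dirs R) D) Ps _) Ds) (∑-*ʳ _ Ds _)) Rs ⟩
    ∑ Rs (λ R → ∑ Ds (δ-dir (dirs R)) * ∑ Ps (δ-pos (pos R)))
      ≤⟨ ∑-mono (λ R → *-mono-≤ (Indicator.∑-δ≤1 (≡-dec Bool._≟_) (dirs R) (Unique-subsets k ℓ))
           (Indicator.∑-δ≤1 (≡-dec Fin._≟_) (pos R) (Unique-points n k))) Rs ⟩
    ∑ Rs (λ _ → 1)
      ≡⟨ trans (∑-const 1 Rs) (*-identityʳ (length Rs)) ⟩
    length Rs ∎
    where
    open ≤-Reasoning
    Ds : List (Subset k)
    Ds = subsets k ℓ
    Ps : List (Point n k)
    Ps = points n k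

  open module Occ (D : Subset k) = Occupation (rooks D) public

  1≤occ : ∀ {R} → R ∈ Rs → ∀ i {Q} x → Q [ i ]≔ x ≡ pos R → 1 ≤ occ (dirs R) i Q
  1≤occ {R} R∈Rs i {Q} x Qx≡P = ⊓-glb ≤-refl (≤-trans
    (≤-trans (1≤rooks R∈Rs) (≤-reflexive (cong (rooks (dirs R)) (sym Qx≡P))))
    (∑-∈ (λ x → rooks (dirs R) (Q [ i ]≔ x)) (∈-allFin x)))

  -- A covered point other than the rook's position lies on a line through that position in a
  -- direction of D. The position itself lies on its line in any direction of D, and D is nonempty
  -- because ℓ ≥ 1.
  Covers⇒1≤covered : 1 ≤ ℓ → ∀ {R Q} → R ∈ Rs → Covers R Q → 1 ≤ covered (dirs R) (directions (dirs R)) Q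
  Covers⇒1≤covered 1≤ℓ {R} {Q} R∈Rs (inj₂ (i , i∈D , _ , agree)) =
    ≤-trans (1≤occ R∈Rs i (lookup (pos R) i) (lookup-ext agree′)) (∑-∈ (λ i → occ (dirs R) i Q) (∈-directions i∈D))
    where
    lookup-ext : ∀ {v u : Point n k} → (∀ j → lookup v j ≡ lookup u j) → v ≡ u
    lookup-ext eq = Pointwise-≡⇒≡ (ext eq)
    agree′ : ∀ j → lookup (Q [ i ]≔ lookup (pos R) i) j ≡ lookup (pos R) j
    agree′ j with j Fin.≟ i
    ... | yes refl = lookup∘update i Q _
    ... | no  j≢i  = trans (lookup∘update′ j≢i Q _) (agree j j≢i)
  Covers⇒1≤covered 1≤ℓ {R} {Q} R∈Rs (inj₁ refl) = nonempty (directions (dirs R)) (trans (length-directions (dirs R)) (size R))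
    where
    nonempty : ∀ is → length is ≡ ℓ → 1 ≤ covered (dirs R) is (pos R)
    nonempty []       len = ⊥-elim (<⇒≢ 1≤ℓ len)
    nonempty (i ∷ is) len = ≤-trans (1≤occ R∈Rs i (lookup (pos R) i) ([]≔-lookup (pos R) i)) (m≤m+n _ _)

  -- Every type satisfies S (S - 1) ≤ ℓ S, and the type of a rook that covers Q satisfies it with ℓ
  -- to spare.
  ∑-overlaps+ℓ≤ : 1 ≤ ℓ → IsRookCover Rs → ∀ Q →
    ∑ (subsets k ℓ) (λ D → 2 * overlaps D (directions D) Q) + ℓ
      ≤ ∑ (subsets k ℓ) (λ D → ℓ * covered D (directions D) Q)
  ∑-overlaps+ℓ≤ 1≤ℓ (_ , covers) Q with R , R∈Rs , R-covers-Q ← covers Q =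
    ∑-mono-∈ (All.map (λ {D} size≡ℓ → subst (λ z → 2 * overlaps D (directions D) Q ≤ z * covered D (directions D) Q)
        (trans (length-directions D) size≡ℓ) (overlaps≤ D (directions D) Q)) (size-subsets k ℓ))
      (subst (λ z → dirs R ∈ subsets k z) (size R) (∈-subsets (dirs R)))
      (subst (λ z → 2 * overlaps (dirs R) (directions (dirs R)) Q + z ≤ z * covered (dirs R) (directions (dirs R)) Q)
        (trans (length-directions (dirs R)) (size R))
        (overlaps+length≤ (dirs R) (directions (dirs R)) Q (Covers⇒1≤covered 1≤ℓ R∈Rs R-covers-Q)))

-- The lower bound for a rook cover

private
  length-cover-ring₁ : ∀ t s n P → suc t * n * (s * s * P) ≡ s * s * (n * P * suc t)
  length-cover-ring₁ = solve-∀
  length-cover-ring₂ : ∀ t p s w n m c P → suc t * (s * w) * (n * m) + c * (n * P * (suc t * (t * (p * p))))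
    ≡ suc t * n * (s * w * m + t * (p * p) * c * P)
  length-cover-ring₂ = solve-∀

-- `∑-overlaps+ℓ≤`, summed over all points and multiplied by s², bounds s² Σ S_D (S_D - 1) plus a
-- constant by ℓ s² Σ S_D. By `∑-covered≤` for each type, ℓ s² Σ S_D is at most the same s² Σ S_D
-- (S_D - 1) plus terms in the number of rooks and in n. The common term cancels, and so does the
-- factor ℓ n.
length-cover-bound : ∀ {n k t} .{{_ : NonZero n}} (p s w : ℕ) → t * p ≤ s → w + 2 * (t * p) ≡ suc t * s →
  (Rs : List (Rook n (suc k) (suc t))) → IsRookCover Rs →
  s * s * n ^ k ≤ s * w * length Rs + t * (p * p) * (suc k C suc t) * n ^ k
length-cover-bound {n} {k} {t} p s w tp≤s w-eq Rs cover = *-cancelˡ-≤ (suc t * n) (begin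
  suc t * n * (s * s * n ^ k)
    ≡⟨ length-cover-ring₁ t s n (n ^ k) ⟩
  s * s * (n ^ suc k * suc t)
    ≤⟨ +-cancelˡ-≤ (s * s * ∑ Ps E) _ _ total ⟩
  suc t * (s * w) * (n * length Rs) + (suc k C suc t) * (n ^ suc k * (suc t * (t * (p * p))))
    ≡⟨ length-cover-ring₂ t p s w n (length Rs) (suc k C suc t) (n ^ k) ⟩
  suc t * n * (s * w * length Rs + t * (p * p) * (suc k C suc t) * n ^ k) ∎)
  where
  open ≤-Reasoning
  Ps : List (Point n (suc k))
  Ps = points n (suc k)
  Ds : List (Subset (suc k))
  Ds = subsets (suc k) (suc t)
  cov over : Subset (suc k) → Point n (suc k) → ℕ
  cov D  = covered Rs D (directions D)
  over D = overlaps Rs D (directions D)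
  E : Point n (suc k) → ℕ
  E Q = ∑ Ds (λ D → 2 * over D Q)
  perType : ∀ {D} → ∣ D ∣ ≡ suc t → ∑ Ps (λ Q → suc t * (s * s) * cov D Q)
    ≤ ∑ Ps (λ Q → s * s * (2 * over D Q) + suc t * (s * w) * (n * rooks Rs D Q) + suc t * (t * (p * p)))
  perType {D} size≡ = ∑-covered≤ Rs D t p s w tp≤s w-eq (directions D) (Unique-directions D)
    (trans (length-directions D) size≡)
  ∑-Ps-const : ∀ c → ∑ Ps (λ _ → c) ≡ n ^ suc k * c
  ∑-Ps-const c = trans (∑-const c Ps) (cong (_* c) (length-points n (suc k)))
  split : ∀ D →
    ∑ Ps (λ Q → s * s * (2 * over D Q) + suc t * (s * w) * (n * rooks Rs D Q) + suc t * (t * (p * p)))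
    ≡ s * s * ∑ Ps (λ Q → 2 * over D Q) + suc t * (s * w) * (n * ∑ Ps (rooks Rs D))
      + n ^ suc k * (suc t * (t * (p * p)))
  split D = trans (∑-+ Ps _ _) (cong₂ _+_
    (trans (∑-+ Ps _ _) (cong₂ _+_ (∑-*ˡ (s * s) Ps _)
      (trans (∑-*ˡ (suc t * (s * w)) Ps _) (cong (suc t * (s * w) *_) (∑-*ˡ n Ps _)))))
    (∑-Ps-const _))
  total : s * s * ∑ Ps E + s * s * (n ^ suc k * suc t)
    ≤ s * s * ∑ Ps E
      + (suc t * (s * w) * (n * length Rs) + (suc k C suc t) * (n ^ suc k * (suc t * (t * (p * p)))))
  total = begin
    s * s * ∑ Ps E + s * s * (n ^ suc k * suc t)
      ≡⟨ *-distribˡ-+ (s * s) (∑ Ps E) _ ⟨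
    s * s * (∑ Ps E + n ^ suc k * suc t)
      ≡⟨ cong (s * s *_) (trans (∑-+ Ps E _) (cong (∑ Ps E +_) (∑-Ps-const (suc t)))) ⟨
    s * s * ∑ Ps (λ Q → E Q + suc t)
      ≤⟨ *-monoʳ-≤ (s * s) (∑-mono (∑-overlaps+ℓ≤ Rs (s≤s z≤n) cover) Ps) ⟩
    s * s * ∑ Ps (λ Q → ∑ Ds (λ D → suc t * cov D Q))
      ≡⟨ cong (s * s *_) (∑-swap Ps Ds _) ⟩
    s * s * ∑ Ds (λ D → ∑ Ps (λ Q → suc t * cov D Q))
      ≡⟨ ∑-*ˡ (s * s) Ds _ ⟨
    ∑ Ds (λ D → s * s * ∑ Ps (λ Q → suc t * cov D Q))
      ≡⟨ ∑-cong (λ D → trans (sym (∑-*ˡ (s * s) Ps _)) (∑-cong (λ Q →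
           trans (sym (*-assoc (s * s) (suc t) _)) (cong (_* cov D Q) (*-comm (s * s) (suc t)))) Ps)) Ds ⟩
    ∑ Ds (λ D → ∑ Ps (λ Q → suc t * (s * s) * cov D Q))
      ≤⟨ ∑-mono-All (All.map (λ {D} → perType {D}) (size-subsets (suc k) (suc t))) ⟩
    ∑ Ds (λ D → ∑ Ps (λ Q → s * s * (2 * over D Q) + suc t * (s * w) * (n * rooks Rs D Q) + suc t * (t * (p * p))))
      ≡⟨ ∑-cong split Ds ⟩
    ∑ Ds (λ D → s * s * ∑ Ps (λ Q → 2 * over D Q) + suc t * (s * w) * (n * ∑ Ps (rooks Rs D))
      + n ^ suc k * (suc t * (t * (p * p))))
      ≡⟨ trans (∑-+ Ds _ _) (cong₂ _+_
           (trans (∑-+ Ds _ _) (cong₂ _+_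
             (trans (∑-*ˡ (s * s) Ds _) (cong (s * s *_) (∑-swap Ds Ps _)))
             (trans (∑-*ˡ (suc t * (s * w)) Ds _) (cong (suc t * (s * w) *_) (∑-*ˡ n Ds _)))))
           (trans (∑-const _ Ds) (cong (_* (n ^ suc k * (suc t * (t * (p * p))))) (length-subsets (suc k) (suc t))))) ⟩
    s * s * ∑ Ps E + suc t * (s * w) * (n * ∑ Ds (λ D → ∑ Ps (rooks Rs D)))
      + (suc k C suc t) * (n ^ suc k * (suc t * (t * (p * p))))
      ≤⟨ +-monoˡ-≤ _ (+-monoʳ-≤ (s * s * ∑ Ps E)
           (*-monoʳ-≤ (suc t * (s * w)) (*-monoʳ-≤ n (∑-rooks≤length Rs)))) ⟩
    s * s * ∑ Ps E + suc t * (s * w) * (n * length Rs)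
      + (suc k C suc t) * (n ^ suc k * (suc t * (t * (p * p))))
      ≡⟨ +-assoc (s * s * ∑ Ps E) _ _ ⟩
    s * s * ∑ Ps E
      + (suc t * (s * w) * (n * length Rs) + (suc k C suc t) * (n ^ suc k * (suc t * (t * (p * p))))) ∎
  instance
    ℓ*n≢0 : NonZero (suc t * n)
    ℓ*n≢0 = m*n≢0 (suc t) n

theorem8 : ∀ (k ℓ : ℕ) → 1 ≤ ℓ → ℓ ≤ k → ∀ (p q : ℕ) → 0 < q → BelowBound k ℓ p q →
    ∃[ N ] (∀ (n : ℕ) → N ≤ n → ∀ (Rs : List (Rook n k ℓ)) → IsRookCover Rs →
    p * n ^ (k ∸ 1) ≤ q * length Rs)
-- The estimate is valid for every n ≥ 1, so the threshold is 1; n > 0 is what allows dividing by n.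
theorem8 (suc k) (suc t) _ _ p q _ below = 1 , bound
  where
  -- With s = q c the point of tangency is M = n p / s, and w encodes the slope there; `w-eq`
  -- confirms that the truncated subtraction is exact.
  s w : ℕ
  s = q * (suc k C suc t)
  w = suc t * s ∸ 2 * (t * p)
  tp≤s : t * p ≤ s
  tp≤s = ≤-trans (tp≤q (suc k) t p q below)
    (m≤m*n q (suc k C suc t) {{>-nonZero (1≤kCℓ (suc k) (suc t) p q below)}})
  2tp≤ℓs : ∀ t → t * p ≤ s → 2 * (t * p) ≤ suc t * s
  2tp≤ℓs zero    _    = z≤n
  -- For t ≥ 1 one has 2 ≤ ℓ, which is multiplied by t p ≤ s.
  2tp≤ℓs (suc r) tp≤s = *-mono-≤ (s≤s (s≤s (z≤n {r}))) tp≤s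
  w-eq : w + 2 * (t * p) ≡ suc t * s
  w-eq = m∸n+n≡m (2tp≤ℓs t tp≤s)
  bound : ∀ n → 1 ≤ n → (Rs : List (Rook n (suc k) (suc t))) → IsRookCover Rs → p * n ^ k ≤ q * length Rs
  bound n@(suc _) _ Rs cover = tangent-sum⇒ (suc k) t p q w (n ^ k) (length Rs) below w-eq
    (length-cover-bound p s w tp≤s w-eq Rs cover)
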